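{- Let $G$ be a circle graph with clique number $\omega$. Then the vertex set of $G$ can be partitioned into $7\omega$ (possibly empty) sets, each of which induces a permutation graph in $G$.
   Context: An interval system is a finite set $\mathcal{I}$ of open intervals $(a,b)$, $a<b$, contained in $(0,1)$, such that no two distinct intervals share an end and no interval has $0$ or $1$ as an end. Two intervals overlap if they intersect and neither is contained in the other. The overlap graph $G(\mathcal{I})$ is the graph with vertex set $\mathcal{I}$ in which two vertices are adjacent if and only if they overlap as intervals. A graph is a circle graph if it is isomorphic to the overlap graph of an interval system. A pillar of an interval system $\mathcal{I}$ is a point of $(0,1)$ that is not an end of any interval in $\mathcal{I}$. A graph is a permutation graph if it is isomorphic to the overlap graph of an interval system for which there exists a pillar contained in every interval of the system. -}

module Defs where

open import Data.Fin.Base using (Fin)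
open import Data.Nat.Base as ℕ using (ℕ)
open import Data.Product.Base using (Σ; ∃; ∃-syntax; _×_; _,_)
open import Data.Rational.Base as ℚ using (ℚ; 0ℚ; 1ℚ)
import Data.Rational.Properties as ℚₚ
open import Data.Refinement.Base using (Refinement; value)
open import Data.Sum.Base using (_⊎_; inj₁; inj₂)
open import Function.Base using (id)
open import Function.Bundles using (_⇔_; _↔_; _↣_; mk⇔; Inverse; Injection)
open import Level using (Level; 0ℓ; _⊔_) renaming (suc to lsuc)
open import Relation.Binary.Core using (Rel)
open import Relation.Binary.Definitions using (Symmetric; Irreflexive; tri<; tri≈; tri>)
open import Relation.Binary.PropositionalEquality.Core using (_≡_; _≢_; refl; subst)
open import Relation.Nullary.Negation.Core using (¬_)
open import Relation.Unary using (Pred; _∈_; _⊆_; _≬_)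

private
  variable
    v e v′ e′ p : Level

------------------------------------------------------------------------
-- Real numbers, as two-sided Dedekind cuts of ℚ

record ℝ : Set₁ where
  field
    lower upper     : Pred ℚ 0ℓ
    lower-inhabited : ∃ lower
    upper-inhabited : ∃ upper
    lower-rounded   : ∀ q → lower q ⇔ (∃[ r ] q ℚ.< r × lower r)
    upper-rounded   : ∀ q → upper q ⇔ (∃[ r ] r ℚ.< q × upper r)
    disjoint        : ∀ q → ¬ (lower q × upper q)
    located         : ∀ {q r} → q ℚ.< r → lower q ⊎ upper r

open ℝ

infix 4 _<_ _#_

_<_ : Rel ℝ 0ℓ
x < y = ∃[ q ] upper x q × lower y q

-- Apartness, the constructive form of "x ≠ y" for real numbers
-- (classically the two are equivalent).

_#_ : Rel ℝ 0ℓ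
x # y = x < y ⊎ y < x

fromℚ : ℚ → ℝ
fromℚ a = record
  { lower           = ℚ._< a
  ; upper           = a ℚ.<_
  ; lower-inhabited = a ℚ.+ ℚ.- 1ℚ
                    , subst (a ℚ.+ ℚ.- 1ℚ ℚ.<_) (ℚₚ.+-identityʳ a)
                        (ℚₚ.+-monoʳ-< a (ℚₚ.negative⁻¹ (ℚ.- 1ℚ)))
  ; upper-inhabited = a ℚ.+ 1ℚ
                    , subst (ℚ._< a ℚ.+ 1ℚ) (ℚₚ.+-identityʳ a)
                        (ℚₚ.+-monoʳ-< a (ℚₚ.positive⁻¹ 1ℚ))
  ; lower-rounded   = λ q → mk⇔ ℚₚ.<-dense λ (_ , q<r , r<a) → ℚₚ.<-trans q<r r<a
  ; upper-rounded   = λ q → mk⇔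
      (λ a<q → let r , a<r , r<q = ℚₚ.<-dense a<q in r , r<q , a<r)
      (λ (_ , r<q , a<r) → ℚₚ.<-trans a<r r<q)
  ; disjoint        = λ _ (q<a , a<q) → ℚₚ.<-asym q<a a<q
  ; located         = located′
  }
  where
  located′ : ∀ {q r} → q ℚ.< r → q ℚ.< a ⊎ a ℚ.< r
  located′ {q} q<r with ℚₚ.<-cmp q a
  ... | tri< q<a _    _ = inj₁ q<a
  ... | tri≈ _   refl _ = inj₂ q<r
  ... | tri> _   _  a<q = inj₂ (ℚₚ.<-trans a<q q<r)

0ℝ 1ℝ : ℝ
0ℝ = fromℚ 0ℚ
1ℝ = fromℚ 1ℚ

------------------------------------------------------------------------
-- Simple graphs

record Graph v e : Set (lsuc (v ⊔ e)) where
  field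
    Vertex : Set v
    Adj    : Rel Vertex e
    sym    : Symmetric Adj
    irrefl : Irreflexive _≡_ Adj

open Graph

record _≅_ (G : Graph v e) (H : Graph v′ e′) : Set (v ⊔ e ⊔ v′ ⊔ e′) where
  field
    bijection : Vertex G ↔ Vertex H
    adjacency : ∀ {x y} → Adj G x y ⇔
                Adj H (Inverse.to bijection x) (Inverse.to bijection y)

-- The proof component of a Refinement is irrelevant, so the vertices of
-- an induced subgraph are the elements of the subset, without multiplicity.

induced : (G : Graph v e) → Pred (Vertex G) p → Graph (v ⊔ p) e
induced G P = record
  { Vertex = Refinement (Vertex G) P
  ; Adj    = λ x y → Adj G (value x) (value y)
  ; sym    = sym G
  ; irrefl = λ { refl → irrefl G refl }
  }

HasClique : Graph v e → ℕ → Set (v ⊔ e)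
HasClique G k = Σ (Fin k ↣ Vertex G) λ f →
  ∀ {i j} → i ≢ j → Adj G (Injection.to f i) (Injection.to f j)

IsCliqueNumber : Graph v e → ℕ → Set (v ⊔ e)
IsCliqueNumber G ω = HasClique G ω × (∀ k → HasClique G k → k ℕ.≤ ω)

------------------------------------------------------------------------
-- Interval systems and their overlap graphs

record Interval : Set₁ where
  constructor interval
  field
    left right : ℝ
    left<right : left < right

open Interval

⟦_⟧ : Interval → Pred ℝ 0ℓ
⟦ I ⟧ x = left I < x × x < right I

0<1 : 0ℝ < 1ℝ
0<1 = ℚ.½ , ℚₚ.positive⁻¹ ℚ.½ , ℚ.*<* (ℤ.+<+ ℕₚ.≤-refl)
  where
  import Data.Integer.Base as ℤ
  import Data.Nat.Properties as ℕₚ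

unit : Interval
unit = interval 0ℝ 1ℝ 0<1

NotEnd : ℝ → Interval → Set
NotEnd x I = x # left I × x # right I

-- A set of n intervals is given by an enumeration; `disjointEnds` makes
-- the enumeration injective.

record IntervalSystem (n : ℕ) : Set₁ where
  field
    intervals    : Fin n → Interval
    contained    : ∀ i → ⟦ intervals i ⟧ ⊆ ⟦ unit ⟧
    disjointEnds : ∀ {i j} → i ≢ j →
                   NotEnd (left  (intervals i)) (intervals j) ×
                   NotEnd (right (intervals i)) (intervals j)
    0-notEnd     : ∀ i → NotEnd 0ℝ (intervals i)
    1-notEnd     : ∀ i → NotEnd 1ℝ (intervals i)

open IntervalSystem

Overlap : Rel Interval (lsuc 0ℓ)
Overlap I J = ⟦ I ⟧ ≬ ⟦ J ⟧ × ¬ (⟦ I ⟧ ⊆ ⟦ J ⟧) × ¬ (⟦ J ⟧ ⊆ ⟦ I ⟧)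

overlapGraph : ∀ {n} → IntervalSystem n → Graph 0ℓ (lsuc 0ℓ)
overlapGraph {n} S = record
  { Vertex = Fin n
  ; Adj    = λ i j → Overlap (intervals S i) (intervals S j)
  ; sym    = λ ((x , x∈I , x∈J) , I⊈J , J⊈I) → (x , x∈J , x∈I) , J⊈I , I⊈J
  ; irrefl = λ { refl (_ , I⊈I , _) → I⊈I id }
  }

IsPillar : ∀ {n} → IntervalSystem n → Pred ℝ 0ℓ
IsPillar S x = x ∈ ⟦ unit ⟧ × (∀ i → NotEnd x (intervals S i))

IsCircleGraph : Graph v e → Set (v ⊔ e ⊔ lsuc 0ℓ)
IsCircleGraph G = ∃[ n ] Σ (IntervalSystem n) λ S → G ≅ overlapGraph S

IsPermutationGraph : Graph v e → Set (v ⊔ e ⊔ lsuc 0ℓ)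
IsPermutationGraph G = ∃[ n ] Σ (IntervalSystem n) λ S →
  (∃[ x ] IsPillar S x × (∀ i → x ∈ ⟦ intervals S i ⟧)) × G ≅ overlapGraph S

-- Number the ends of the intervals, so that only their order matters. Pillars
-- are introduced one by one, each splitting a segment in two; an interval
-- belongs to the first pillar that it contains. The positions outside a
-- segment are thereby divided into blocks, one per earlier pillar, and a new
-- pillar need only avoid the colours of the blocks seen by the segment, those
-- joined to it by an interval. Two exits of a segment whose ends increase
-- strictly (cyclically) on both sides overlap, so patience sorting of the
-- blocks met along the segment uses at most ω piles. A segment seeing at most
-- 5ω blocks changes its piles at most 5ω² times, and a stretch with at most 2ω
-- changes sees at most 3ω blocks. As 5ω² < 4^ω · 2ω, a binary tree of depth 2ω
-- of pillars cuts the segment into such stretches; each of them also sees at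
-- most 2ω of the new blocks, hence again at most 5ω in all, and 5ω + 2ω
-- colours suffice.

module Submission where

open import Defs renaming (_<_ to _<ℝ_; _#_ to _#ℝ_)
open import Data.Empty using (⊥; ⊥-elim)
open import Data.Fin.Base as Fin using (Fin; zero; suc)
import Data.Fin.Properties as Fin
open import Data.Irrelevant using ([_])
import Data.Integer.Base as ℤ
open import Data.List.Base using (List; []; _∷_; allFin; _++_; map; length; filter; lookup)
open import Data.List.Properties using (length-map; length-++; filter-some; length-filter)
open import Data.List.Membership.Propositional using (_∈_; _∉_; lose)
open import Data.List.Membership.Propositional.Properties
  using (∈-++⁺ˡ; ∈-++⁺ʳ; ∈-map⁺; ∈-lookup; ∈-allFin; ∈-filter⁺; ∈-filter⁻)
import Data.List.Membership.DecPropositional as DecMembership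
open import Data.List.Relation.Binary.Subset.Propositional using (_⊆_)
open import Data.List.Relation.Binary.Subset.Propositional.Properties using (∷⁺ʳ)
open import Data.List.Relation.Unary.All as All using (All; []; _∷_)
open import Data.List.Relation.Unary.AllPairs using (AllPairs; []; _∷_)
open import Data.List.Relation.Unary.Any as Any using (here; there)
open import Data.List.Relation.Unary.Any.Properties using (lookup-index)
open import Data.List.Relation.Unary.Unique.Propositional.Properties using (allFin⁺; filter⁺)
open import Data.Nat.Base
open import Data.Nat.Properties
open import Data.Nat.Tactic.RingSolver using (solve-∀)
open import Data.Nat.ListAction using (sum)
open import Data.Product.Base using (Σ; ∃-syntax; _×_; _,_; proj₁; proj₂)
import Data.Rational.Base as ℚ
import Data.Rational.Properties as ℚ
open import Data.Rational.Unnormalised.Base as ℚᵘ using (ℚᵘ; mkℚᵘ)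
import Data.Rational.Unnormalised.Properties as ℚᵘ
open import Data.Refinement.Base using (value; _,_)
open import Data.Refinement.Properties using (value-injective)
open import Data.Sum.Base as Sum using (_⊎_; inj₁; inj₂)
open import Data.Sum.Properties as Sum using (inj₁-injective; inj₂-injective)
open import Function.Base using (id; _∘_; const)
open import Function.Bundles using (_⇔_; mk⇔; mk↣; mk↔ₛ′; Equivalence; Inverse)
open import Function.Construct.Composition using (_⇔-∘_)
open import Function.Construct.Symmetry using (⇔-sym)
open import Relation.Binary.Definitions using (tri<; tri≈; tri>)
open import Relation.Binary.PropositionalEquality
  using (_≡_; _≢_; refl; sym; trans; cong; subst; subst₂)
open import Relation.Nullary using (Dec; yes; no; ¬_; ¬?; contradiction)
open import Relation.Nullary.Decidable using (map′; _×-dec_; _⊎-dec_; decidable-stable; recompute)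
open import Relation.Unary using (Decidable)

-- Counting, fresh colours and arithmetic

module _ {A : Set} {P Q : A → Set} (P? : Decidable P) (Q? : Decidable Q)
         (P⇒Q : ∀ a → P a → Q a) where

  filter-length-≤ : ∀ xs → length (filter P? xs) ≤ length (filter Q? xs)
  filter-length-≤ [] = z≤n
  filter-length-≤ (x ∷ xs) with P? x | Q? x
  ... | yes _ | yes _  = s≤s (filter-length-≤ xs)
  ... | yes p | no ¬q  = contradiction (P⇒Q x p) ¬q
  ... | no  _ | yes _  = m≤n⇒m≤1+n (filter-length-≤ xs)
  ... | no  _ | no _   = filter-length-≤ xs

  filter-length-< : ∀ {a xs} → a ∈ xs → Q a → ¬ P a →
                    length (filter P? xs) < length (filter Q? xs)
  filter-length-< {a} {x ∷ xs} (here refl) q ¬p with P? x | Q? x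
  ... | yes p | _     = contradiction p ¬p
  ... | no _  | no ¬q = contradiction q ¬q
  ... | no _  | yes _ = s≤s (filter-length-≤ xs)
  filter-length-< {a} {x ∷ xs} (there a∈) q ¬p with P? x | Q? x
  ... | yes _ | yes _  = s≤s (filter-length-< a∈ q ¬p)
  ... | yes p | no ¬q  = contradiction (P⇒Q x p) ¬q
  ... | no  _ | yes _  = m≤n⇒m≤1+n (filter-length-< a∈ q ¬p)
  ... | no  _ | no _   = filter-length-< a∈ q ¬p

-- If every colour occurred in `cs`, choosing a position for each would map `Fin K` injectively into
-- fewer than `K` positions.
fresh : ∀ {K} (cs : List (Fin K)) → length cs < K → ∃[ κ ] κ ∉ cs
fresh {K} cs short with Fin.any? (λ κ → ¬? (DecMembership._∈?_ Fin._≟_ κ cs))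
... | yes found = found
... | no none = contradiction index-clash (λ (i , j , i<j , eq) →
        Fin.<⇒≢ i<j (trans (lookup-index (all∈ i))
                    (trans (cong (lookup cs) eq) (sym (lookup-index (all∈ j))))))
  where
  all∈ : ∀ κ → κ ∈ cs
  all∈ κ = decidable-stable (DecMembership._∈?_ Fin._≟_ κ cs) (λ κ∉ → none (κ , κ∉))

  index-clash : ∃[ i ] ∃[ j ] i Fin.< j × Any.index (all∈ i) ≡ Any.index (all∈ j)
  index-clash = Fin.pigeonhole short (Any.index ∘ all∈)

4^ω≥3ω : ∀ {ω} → 1 ≤ ω → 3 * ω ≤ 2 ^ (2 * ω)
4^ω≥3ω {suc zero} _ = m≤m+n 3 1
4^ω≥3ω {suc (suc k)} _ = begin
  3 * suc (suc k)            ≤⟨ m≤m+n _ (3 * k) ⟩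
  3 * suc (suc k) + 3 * k    ≡⟨ double k ⟩
  2 * (3 * suc k)            ≤⟨ *-monoʳ-≤ 2 (4^ω≥3ω {suc k} (s≤s z≤n)) ⟩
  2 * 2 ^ (2 * suc k)        ≤⟨ m≤n*m _ 2 ⟩
  2 * (2 * 2 ^ (2 * suc k))  ≡⟨ cong (2 ^_) (sym (twice (suc k))) ⟩
  2 ^ (2 * suc (suc k))      ∎
  where
  open ≤-Reasoning
  double : ∀ k → 3 * suc (suc k) + 3 * k ≡ 2 * (3 * suc k)
  double = solve-∀

  twice : ∀ k → 2 * suc k ≡ suc (suc (2 * k))
  twice = solve-∀

-- The left side bounds the potential of `ω` piles over `5 * ω` blocks; the right side is its rise
-- over `2 ^ (2 * ω)` stretches of `2 * ω` changes each. Strictness comes from the spare `ω * ω`.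
budget : ∀ {ω} → 1 ≤ ω → ω * (5 * ω) < 2 ^ (2 * ω) * (2 * ω)
budget {ω} ω≥1 = begin-strict
  ω * (5 * ω)              ≡⟨ +-identityʳ _ ⟨
  ω * (5 * ω) + 0          <⟨ +-monoʳ-< _ (*-mono-≤ ω≥1 ω≥1) ⟩
  ω * (5 * ω) + ω * ω      ≡⟨ six ω ⟩
  3 * ω * (2 * ω)          ≤⟨ *-monoˡ-≤ (2 * ω) (4^ω≥3ω ω≥1) ⟩
  2 ^ (2 * ω) * (2 * ω)    ∎
  where
  open ≤-Reasoning
  six : ∀ w → w * (5 * w) + w * w ≡ 3 * w * (2 * w)
  six = solve-∀

-- Prolongs a colouring of the outside of a segment to the outside of one half: in the cyclic
-- numbering the other half comes before or after the old positions.
glue : ∀ {A : Set} → ℕ → (ℕ → A) → (ℕ → A) → ℕ → A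
glue m f g o with o <? m
... | yes _ = f o
... | no _  = g o

module _ {A : Set} {m : ℕ} {f g : ℕ → A} {o : ℕ} where

  glue-< : o < m → glue m f g o ≡ f o
  glue-< o<m with o <? m
  ... | yes _   = refl
  ... | no o≮m  = contradiction o<m o≮m

  glue-≥ : m ≤ o → glue m f g o ≡ g o
  glue-≥ m≤o with o <? m
  ... | yes o<m = contradiction m≤o (<⇒≱ o<m)
  ... | no _    = refl

-- Chord diagrams on integer positions

module Crossings {n : ℕ} (l r : Fin n → ℕ) where

  Cross : Fin n → Fin n → Set
  Cross i j = l i < l j × l j < r i × r i < r j

  Crossing : Fin n → Fin n → Set
  Crossing i j = Cross i j ⊎ Cross j i

-- Pillar `q` stands for the point just before position `q`, hence one strict and one weak
-- inequality in `pierces`. By `separate`, chords of one colour fall into groups, each with a common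
-- pillar, and different groups do not cross.
record PillarColouring {n : ℕ} (l r : Fin n → ℕ) (C : Set) : Set where
  open Crossings l r
  field
    pillar   : Fin n → ℕ
    colour   : Fin n → C
    pierces  : ∀ i → l i < pillar i × pillar i ≤ r i
    separate : ∀ {i j} → colour i ≡ colour j → Crossing i j → pillar i ≡ pillar j

module ChordDiagram {n : ℕ} (N : ℕ) (l r : Fin n → ℕ)
  (l<r : ∀ i → l i < r i) (r<N : ∀ i → r i < N)
  (l-injective : ∀ {i j} → l i ≡ l j → i ≡ j)
  (r-injective : ∀ {i j} → r i ≡ r j → i ≡ j)
  (l≢r : ∀ {i j} → l i ≢ r j) where

  open Crossings l r

  -- Positions outside a segment [s , t) are numbered t, …, s + N - 1 in
  -- cyclic order, so that a left end a < s is seen as a + N.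
  Link : Fin n → ℕ → ℕ → Set
  Link i z o = (l i ≡ z × r i ≡ o) ⊎ (r i ≡ z × l i + N ≡ o)

  Exit : ℕ → ℕ → ℕ → ℕ → Set
  Exit s t z o = ∃[ i ] Link i z o × t ≤ o × o < s + N

  exit? : ∀ s t z → Dec (∃[ o ] Exit s t z o)
  exit? s t z = map′ to from (Fin.any? λ i →
      (l i ≟ z ×-dec (t ≤? r i ×-dec r i <? s + N)) ⊎-dec
      (r i ≟ z ×-dec (t ≤? l i + N ×-dec l i + N <? s + N)))
    where
    to : _ → ∃[ o ] Exit s t z o
    to (i , inj₁ (lz , b)) = r i , i , inj₁ (lz , refl) , b
    to (i , inj₂ (rz , b)) = l i + N , i , inj₂ (rz , refl) , b

    from : ∃[ o ] Exit s t z o → _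
    from (_ , i , inj₁ (lz , refl) , b) = i , inj₁ (lz , b)
    from (_ , i , inj₂ (rz , refl) , b) = i , inj₂ (rz , b)

  -- No two ends share a position, so the exit found by `exit?` stands for all exits from `z`.
  link-unique : ∀ {i j z o o′} → Link i z o → Link j z o′ → o ≡ o′
  link-unique (inj₁ (refl , refl)) (inj₁ (e , refl)) = cong r (l-injective (sym e))
  link-unique (inj₁ (refl , refl)) (inj₂ (e , refl)) = contradiction (sym e) l≢r
  link-unique (inj₂ (refl , refl)) (inj₁ (e , refl)) = contradiction e l≢r
  link-unique (inj₂ (refl , refl)) (inj₂ (e , refl)) = cong (λ i → l i + N) (r-injective (sym e))

  -- The four ends come in the cyclic order `z`, `z′`, `o`, `o′`, so the chords interleave. The
  -- cases tell on which side each chord leaves; left then right is impossible, as positions to the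
  -- left are numbered from `N` on.
  exits-cross : ∀ {s t i j z z′ o o′} → Link i z o → Link j z′ o′ →
                s ≤ z → z < z′ → z′ < t → t ≤ o → o < o′ → o′ < s + N → Crossing i j
  exits-cross (inj₁ (refl , refl)) (inj₁ (refl , refl)) s≤z z<z′ z′<t t≤o o<o′ _ =
    inj₁ (z<z′ , <-≤-trans z′<t t≤o , o<o′)
  exits-cross (inj₁ (refl , refl)) (inj₂ (refl , refl)) s≤z z<z′ z′<t t≤o o<o′ o′< =
    inj₂ (<-≤-trans (+-cancelʳ-< N _ _ o′<) s≤z , z<z′ , <-≤-trans z′<t t≤o)
  exits-cross {i = i} {j} (inj₂ (refl , refl)) (inj₁ (refl , refl)) s≤z z<z′ z′<t t≤o o<o′ _ =
    contradiction (≤-<-trans (m≤n+m N (l i)) (<-trans o<o′ (r<N j))) (<-irrefl refl)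
  exits-cross (inj₂ (refl , refl)) (inj₂ (refl , refl)) s≤z z<z′ z′<t t≤o o<o′ o′< =
    inj₁ (+-cancelʳ-< N _ _ o<o′ , <-≤-trans (+-cancelʳ-< N _ _ o′<) s≤z , z<z′)

  -- Cutting a segment at a pillar

  module _ {C : Set} where

    -- χ colours the outside of the segment [s , t), numbered as for Exit.
    record Solution (s t : ℕ) (χ : ℕ → C) : Set where
      field
        pillar   : Fin n → ℕ
        colour   : Fin n → C
        pierces  : ∀ i → s ≤ l i → r i < t → l i < pillar i × pillar i ≤ r i
        separate : ∀ i j → s ≤ l i → r i < t → s ≤ l j → r j < t →
                   Cross i j → colour i ≡ colour j → pillar i ≡ pillar j
        -- Such an exit crosses chord `i`; `χ o` is meant as the colour that its chord gets from the
        -- pillar first separating its ends.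
        avoids   : ∀ i → s ≤ l i → r i < t → ∀ {z o} → l i < z → z < r i →
                   Exit s t z o → colour i ≢ χ o

    -- A chord needs two positions, so none lies in the segment and the default values are
    -- unconstrained.
    trivial-solution : ∀ {s t χ} → t ≤ suc s → C → Solution s t χ
    trivial-solution {s} {t} t≤1+s c = record
      { pillar   = const 0
      ; colour   = const c
      ; pierces  = λ i s≤l r<t → ⊥-elim (empty i s≤l r<t)
      ; separate = λ i j s≤l r<t _ _ _ _ → ⊥-elim (empty i s≤l r<t)
      ; avoids   = λ i s≤l r<t _ _ _ → ⊥-elim (empty i s≤l r<t)
      }
      where
      empty : ∀ i → s ≤ l i → r i < t → ⊥
      empty i s≤l r<t =
        <-irrefl refl (≤-<-trans s≤l (<-≤-trans (l<r i) (s≤s⁻¹ (<-≤-trans r<t t≤1+s))))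

    -- Chords passing over `q` get pillar `q` and colour `κ`, the others are left to the halves.
    -- Each half regards the other as coloured `κ`, so its chords avoid `κ` when they cross a chord
    -- over `q`.
    join : ∀ {s t χ} q (κ : C) → s < q → q ≤ t → t ≤ N →
           (∀ {z o} → s ≤ z → z < t → Exit s t z o → κ ≢ χ o) →
           Solution s q (glue t (const κ) χ) → Solution q t (glue (s + N) χ (const κ)) →
           Solution s t χ
    join {s} {t} {χ} q κ s<q q≤t t≤N κ-avoids SL SR = record
      { pillar   = λ i → pillar i (side i)
      ; colour   = λ i → colour i (side i)
      ; pierces  = λ i → pierces i (side i)
      ; separate = λ i j → separate i j (side i) (side j)
      ; avoids   = λ i → avoids i (side i)
      }
      where
      module L = Solution SL
      module R = Solution SR

      data Side (i : Fin n) : Set where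
        left   : r i < q → Side i
        right  : q ≤ l i → Side i
        middle : l i < q → q ≤ r i → Side i

      side : ∀ i → Side i
      side i with r i <? q | q ≤? l i
      ... | yes p | _     = left p
      ... | no _  | yes p = right p
      ... | no ¬p | no ¬q = middle (≰⇒> ¬q) (≮⇒≥ ¬p)

      pillar : ∀ i → Side i → ℕ
      pillar i (left _)     = L.pillar i
      pillar i (right _)    = R.pillar i
      pillar i (middle _ _) = q

      colour : ∀ i → Side i → C
      colour i (left _)     = L.colour i
      colour i (right _)    = R.colour i
      colour i (middle _ _) = κ

      pierces : ∀ i (a : Side i) → s ≤ l i → r i < t → l i < pillar i a × pillar i a ≤ r i
      pierces i (left r<q)       s≤l r<t = L.pierces i s≤l r<q
      pierces i (right q≤l)      s≤l r<t = R.pierces i q≤l r<t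
      pierces i (middle l<q q≤r) s≤l r<t = l<q , q≤r

      separate : ∀ i j (a : Side i) (b : Side j) → s ≤ l i → r i < t → s ≤ l j → r j < t →
                 Cross i j → colour i a ≡ colour j b → pillar i a ≡ pillar j b
      separate i j (left r<q) (left r<q′) si it sj jt x = L.separate i j si r<q sj r<q′ x
      separate i j (left r<q) (right q≤l) si it sj jt (_ , lj<ri , _) _ =
        contradiction (<-trans lj<ri r<q) (≤⇒≯ q≤l)
      -- From the left half, `j` is an exit starting inside `i` and ending in the part coloured `κ`.
      separate i j (left r<q) (middle l<q q≤r) si it sj jt (li<lj , lj<ri , _) eq =
        contradiction (trans eq (sym (glue-< jt)))
          (L.avoids i si r<q li<lj lj<ri
            (j , inj₁ (refl , refl) , q≤r , <-≤-trans (r<N j) (m≤n+m N s)))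
      separate i j (right q≤l) (left r<q) si it sj jt (li<lj , _) _ =
        contradiction (≤-<-trans q≤l (<-trans li<lj (<-trans (l<r j) r<q))) (<-irrefl refl)
      separate i j (right q≤l) (right q≤l′) si it sj jt x = R.separate i j q≤l it q≤l′ jt x
      separate i j (right q≤l) (middle l<q _) si it sj jt (li<lj , _) _ =
        contradiction (≤-<-trans q≤l (<-trans li<lj l<q)) (<-irrefl refl)
      separate i j (middle l<q q≤r) (left r<q) si it sj jt (_ , _ , ri<rj) _ =
        contradiction (≤-<-trans q≤r (<-trans ri<rj r<q)) (<-irrefl refl)
      -- Symmetrically, `i` is an exit of the right half, ending at `l i + N` in the part coloured
      -- `κ`.
      separate i j (middle l<q q≤r) (right q≤l) si it sj jt (_ , lj<ri , ri<rj) eq =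
        contradiction (trans (sym eq) (sym (glue-≥ (+-monoˡ-≤ N si))))
          (R.avoids j q≤l jt lj<ri ri<rj
            (i , inj₂ (refl , refl) , ≤-trans t≤N (m≤n+m N (l i)) , +-monoˡ-< N l<q))
      separate i j (middle _ _) (middle _ _) si it sj jt x eq = refl

      avoids : ∀ i (a : Side i) → s ≤ l i → r i < t → ∀ {z o} → l i < z → z < r i →
               Exit s t z o → colour i a ≢ χ o
      avoids i (left r<q) si it l<z z<r (j , lk , t≤o , o<) eq =
        L.avoids i si r<q l<z z<r (j , lk , ≤-trans q≤t t≤o , o<)
          (trans eq (sym (glue-≥ t≤o)))
      avoids i (right q≤l) si it l<z z<r (j , lk , t≤o , o<) eq =
        R.avoids i q≤l it l<z z<r (j , lk , t≤o , <-trans o< (+-monoˡ-< N s<q))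
          (trans eq (sym (glue-< o<)))
      avoids i (middle _ _) si it l<z z<r e =
        κ-avoids (≤-trans si (<⇒≤ l<z)) (<-trans z<r it) e

  -- Blocks outside a segment

  -- A segment [s , t) whose outside is divided into blocks of consecutive
  -- positions: block o is the first position of the block of o.

  record Blocks (C : Set) (s t : ℕ) : Set where
    field
      block   : ℕ → ℕ
      χ       : ℕ → C
      bounded : t ≤ N
      mono    : ∀ {o o′} → t ≤ o → o ≤ o′ → o′ < s + N → block o ≤ block o′
      lower   : ∀ {o} → t ≤ o → o < s + N → t ≤ block o
      upper   : ∀ {o} → t ≤ o → o < s + N → block o ≤ o
      uniform : ∀ {o} → t ≤ o → o < s + N → χ (block o) ≡ χ o

  OnExits : ∀ {C s t} → Blocks C s t → (ℕ → ℕ → ℕ → Set) → Set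
  OnExits {s = s} {t} 𝓑 Q = ∀ {z o} → s ≤ z → z < t → Exit s t z o → Q z o (Blocks.block 𝓑 o)

  Seen : ∀ {C s t} → Blocks C s t → List ℕ → Set
  Seen 𝓑 A = OnExits 𝓑 (λ _ _ p → p ∈ A)

  module _ {C : Set} {s t : ℕ} (𝓑 : Blocks C s t) (q : ℕ) (κ : C) where
    open Blocks 𝓑

    -- The part [q , t) cut off becomes one new block `q`, before all the older ones.
    leftBlocks : q < t → Blocks C s q
    leftBlocks q<t = record
      { block = β ; χ = χ′ ; bounded = ≤-trans (<⇒≤ q<t) bounded
      ; mono = mono′ ; lower = lower′ ; upper = upper′ ; uniform = uniform′ }
      where
      β  = glue t (const q) block
      χ′ = glue t (const κ) χ

      lower′ : ∀ {o} → q ≤ o → o < s + N → q ≤ β o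
      lower′ {o} q≤o o< with o <? t
      ... | yes _  = ≤-refl
      ... | no o≮t = ≤-trans (<⇒≤ q<t) (lower (≮⇒≥ o≮t) o<)

      upper′ : ∀ {o} → q ≤ o → o < s + N → β o ≤ o
      upper′ {o} q≤o o< with o <? t
      ... | yes _  = q≤o
      ... | no o≮t = upper (≮⇒≥ o≮t) o<

      mono′ : ∀ {o o′} → q ≤ o → o ≤ o′ → o′ < s + N → β o ≤ β o′
      mono′ {o} {o′} q≤o o≤o′ o′< with o <? t
      ... | yes _  = lower′ (≤-trans q≤o o≤o′) o′<
      ... | no o≮t rewrite glue-≥ {m = t} {const q} {block} (≤-trans (≮⇒≥ o≮t) o≤o′) =
        mono (≮⇒≥ o≮t) o≤o′ o′<

      uniform′ : ∀ {o} → q ≤ o → o < s + N → χ′ (β o) ≡ χ′ o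
      uniform′ {o} q≤o o< with o <? t
      ... | yes o<t = glue-< q<t
      ... | no o≮t = trans (glue-≥ (lower (≮⇒≥ o≮t) o<)) (uniform (≮⇒≥ o≮t) o<)

    -- The part [s , q) cut off is numbered from `s + N` on, after all older positions, and becomes
    -- one new block `s + N`.
    rightBlocks : s < q → Blocks C q t
    rightBlocks s<q = record
      { block = β ; χ = χ′ ; bounded = bounded
      ; mono = mono′ ; lower = lower′ ; upper = upper′ ; uniform = uniform′ }
      where
      β  = glue (s + N) block (const (s + N))
      χ′ = glue (s + N) χ (const κ)

      upper′ : ∀ {o} → t ≤ o → o < q + N → β o ≤ o
      upper′ {o} t≤o o< with o <? s + N
      ... | yes o<s = upper t≤o o<s
      ... | no o≮s  = ≮⇒≥ o≮s

      lower′ : ∀ {o} → t ≤ o → o < q + N → t ≤ β o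
      lower′ {o} t≤o o< with o <? s + N
      ... | yes o<s = lower t≤o o<s
      ... | no o≮s  = ≤-trans bounded (m≤n+m N s)

      mono′ : ∀ {o o′} → t ≤ o → o ≤ o′ → o′ < q + N → β o ≤ β o′
      mono′ {o} {o′} t≤o o≤o′ o′< with o′ <? s + N
      ... | yes o′<s rewrite glue-< {m = s + N} {block} {const (s + N)} (≤-<-trans o≤o′ o′<s) =
        mono t≤o o≤o′ o′<s
      ... | no _ with o <? s + N
      ...   | yes o<s = ≤-trans (upper t≤o o<s) (<⇒≤ o<s)
      ...   | no _    = ≤-refl

      uniform′ : ∀ {o} → t ≤ o → o < q + N → χ′ (β o) ≡ χ′ o
      uniform′ {o} t≤o o< with o <? s + N
      ... | yes o<s = trans (glue-< (≤-<-trans (upper t≤o o<s) o<s)) (uniform t≤o o<s)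
      ... | no o≮s  = glue-≥ {m = s + N} {χ} {const κ} ≤-refl

    module _ {Q : ℕ → ℕ → ℕ → Set} (old : OnExits 𝓑 Q) where

      -- An exit of the half either enters the new block or is an exit of the whole segment with the
      -- same block number.
      leftExits : (q<t : q < t) → (∀ {z o} → Q z o q) → OnExits (leftBlocks q<t) Q
      leftExits q<t new {z} {o} s≤z z<q (i , link , q≤o , o<) with o <? t
      ... | yes _  = new
      ... | no o≮t = old s≤z (<-trans z<q q<t) (i , link , ≮⇒≥ o≮t , o<)

      rightExits : (s<q : s < q) → (∀ {z o} → Q z o (s + N)) → OnExits (rightBlocks s<q) Q
      rightExits s<q new {z} {o} q≤z z<t (i , link , t≤o , o<) with o <? s + N
      ... | yes o<s = old (≤-trans (<⇒≤ s<q) q≤z) z<t (i , link , t≤o , o<s)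
      ... | no _    = new

  module _ (ω : ℕ) (ω≥1 : 1 ≤ ω)
           (clique≤ : ∀ is → AllPairs Crossing is → length is ≤ ω) where

    -- Patience sorting and the tree of cuts

    module Sorting {C : Set} {s t : ℕ} (𝓑 : Blocks C s t) where
      open Blocks 𝓑

      -- The strict bounds on starts and blocks ensure that an exit from `x` into block `p` or a
      -- later one crosses the whole chain.
      record Chain (x k p : ℕ) : Set where
        constructor chain
        field
          {chords} : List (Fin n)
          size     : length chords ≡ k
          crossing : AllPairs Crossing chords
          exits    : All (λ i → ∃[ z ] ∃[ o ] Link i z o × s ≤ z × z < x × t ≤ o × o < s + N × block o < p)
                         chords

      emptyChain : ∀ {x p} → Chain x 0 p
      emptyChain = chain refl [] []

      chain≤ω : ∀ {x k p} → Chain x k p → k ≤ ω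
      chain≤ω (chain refl cr _) = clique≤ _ cr

      weaken : ∀ {x x′ k p p′} → x ≤ x′ → p ≤ p′ → Chain x k p → Chain x′ k p′
      weaken x≤x′ p≤p′ (chain len cr ex) = chain len cr (All.map
        (λ (z , o , link , s≤z , z<x , t≤o , o< , β<p) →
          z , o , link , s≤z , <-≤-trans z<x x≤x′ , t≤o , o< , <-≤-trans β<p p≤p′) ex)

      extend : ∀ {x k o} → s ≤ x → x < t → Exit s t x o → Chain x k (block o) →
               Chain (suc x) (suc k) (suc (block o))
      extend {x} {k} {o} s≤x x<t (i , link , t≤o , o<) ch@(chain {js} len cr ex) =
        chain (cong suc len) (All.map crosses ex ∷ cr)
          ((x , o , link , s≤x , ≤-refl , t≤o , o< , ≤-refl)
            ∷ Chain.exits (weaken (n≤1+n x) (n≤1+n _) ch))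
        where
        crosses : ∀ {j} → ∃[ z ] ∃[ o′ ] Link j z o′ × s ≤ z × z < x × t ≤ o′ × o′ < s + N ×
                  block o′ < block o → Crossing i j
        crosses (z , o′ , link′ , s≤z , z<x , t≤o′ , o′< , β<β) =
          Sum.swap (exits-cross link′ link s≤z z<x x<t t≤o′
            -- As `block` is monotone, a smaller block number forces a smaller position.
            (≰⇒> (λ o≤o′ → <⇒≱ β<β (mono t≤o o≤o′ o′<))) o<)

      -- Patience sorting of the block numbers: the j-th pile ends a chain of
      -- j crossing chords, so there are at most ω piles. Each change of the
      -- piles replaces a pile by a smaller one or starts a new pile, which
      -- raises the potential Φ; a block met without a change is already a pile.

      data Piles (A : List ℕ) (x k : ℕ) : List ℕ → Set where
        []     : Piles A x k []
        _∷⟨_⟩_ : ∀ {p ps} → Chain x (suc k) (suc p) → p ∈ A → Piles A x (suc k) ps →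
                 Piles A x k (p ∷ ps)

      weakenPiles : ∀ {A x k ps} → Piles A x k ps → Piles A (suc x) k ps
      weakenPiles [] = []
      weakenPiles (ch ∷⟨ p∈A ⟩ π) = weaken (n≤1+n _) ≤-refl ch ∷⟨ p∈A ⟩ weakenPiles π

      -- The last pile ends a chain of `k + length ps` chords; the given chain serves when there is
      -- no pile.
      piles≤ω : ∀ {A x k p ps} → Chain x k p → Piles A x k ps → k + length ps ≤ ω
      piles≤ω {k = k} ch [] rewrite +-identityʳ k = chain≤ω ch
      piles≤ω {k = k} _ (_∷⟨_⟩_ {ps = ps} ch _ π) rewrite +-suc k (length ps) = piles≤ω ch π

      module _ (A : List ℕ) where

        -- Antitone in `p`, so that lowering a pile raises the sum.
        weight : ℕ → ℕ
        weight p = length (filter (p ≤?_) A)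

        Φ : List ℕ → ℕ
        Φ ps = sum (map weight ps)

        Φ≤ : ∀ ps → Φ ps ≤ length ps * length A
        Φ≤ [] = z≤n
        Φ≤ (p ∷ ps) = +-mono-≤ (length-filter (p ≤?_) A) (Φ≤ ps)

        -- `ch` is the chain of the last pile passed, empty at the start. The block goes to the
        -- first pile not below it: an equal pile stays, a larger one is replaced, and past the last
        -- one a new pile starts. Each change prolongs `ch` by the exit.
        insert : ∀ {x k o ps} → s ≤ x → x < t → Exit s t x o → block o ∈ A →
                 Chain x k (block o) → Piles A x k ps →
                 block o ∈ ps ⊎ (∃[ ps′ ] Piles A (suc x) k ps′ × Φ ps < Φ ps′ × ps′ ⊆ block o ∷ ps)
        insert {o = o} s≤x x<t e β∈A ch [] =
          inj₂ ( block o ∷ [] , extend s≤x x<t e ch ∷⟨ β∈A ⟩ []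
               , ≤-trans (filter-some (block o ≤?_) (lose β∈A ≤-refl)) (m≤m+n _ 0) , id)
        insert {o = o} s≤x x<t e β∈A ch (_∷⟨_⟩_ {p} {ps} chₚ p∈A π) with <-cmp (block o) p
        ... | tri< β<p _ _ = inj₂
          ( block o ∷ ps , extend s≤x x<t e ch ∷⟨ β∈A ⟩ weakenPiles π
          -- `block o` counts in its own weight but not in that of `p`.
          , +-monoˡ-< (Φ ps) (filter-length-< (p ≤?_) (block o ≤?_) (λ _ → ≤-trans (<⇒≤ β<p))
              β∈A ≤-refl (<⇒≱ β<p))
          , λ { (here eq) → here eq ; (there a∈) → there (there a∈) })
        ... | tri≈ _ β≡p _ = inj₁ (here β≡p)
        ... | tri> _ _ p<β with insert s≤x x<t e β∈A (weaken ≤-refl p<β chₚ) π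
        ...   | inj₁ β∈ps = inj₁ (there β∈ps)
        ...   | inj₂ (ps′ , π′ , Φ< , ps′⊆) = inj₂
          ( p ∷ ps′ , weaken (n≤1+n _) ≤-refl chₚ ∷⟨ p∈A ⟩ π′ , +-monoʳ-< (weight p) Φ<
          , λ { (here eq) → there (here eq)
              ; (there a∈) → Sum.[ here , there ∘ there ]′ (Any.toSum (ps′⊆ a∈)) })

        -- A stretch [x , end) allowing `b` changes of the piles. By `progress` it stops only at `t`
        -- or once the potential has risen by `b`.
        record Piece (b x : ℕ) (ps B : List ℕ) : Set where
          field
            {end}    : ℕ
            {ps′ B′} : List ℕ
            advance  : x < end ⊎ b ≡ 0 ⊎ x ≡ t
            x≤end    : x ≤ end
            end≤t    : end ≤ t
            piles    : Piles A end 0 ps′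
            grows    : B ⊆ B′
            size     : length B′ ≤ length B + b
            covers   : ∀ {z o} → x ≤ z → z < end → Exit s t z o → block o ∈ B′
            progress : end ≡ t ⊎ Φ ps + b ≤ Φ ps′

        stay : ∀ {b x ps B} → b ≡ 0 ⊎ x ≡ t → x ≤ t → Piles A x 0 ps → Piece b x ps B
        stay {b} {x} {ps} {B} stop x≤t π = record
          { advance = inj₂ stop ; x≤end = ≤-refl ; end≤t = x≤t ; piles = π ; grows = id
          ; size = m≤m+n (length B) b
          ; covers = λ x≤z z<x _ → contradiction x≤z (<⇒≱ z<x)
          ; progress = Sum.swap (Sum.map₁ (λ { refl → ≤-reflexive (+-identityʳ (Φ ps)) }) stop) }

        -- A block met without a change is a current pile, hence already listed; each change adds
        -- one block to the list. The recursion is on the distance `d` to `t` and the remaining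
        -- changes `b`.
        piece : Seen 𝓑 A → ∀ b d {x ps B} → s ≤ x → x + d ≡ t → ps ⊆ B → Piles A x 0 ps → Piece b x ps B
        piece seen zero d s≤x x+d≡t _ π = stay (inj₁ refl) (m+n≤o⇒m≤o _ (≤-reflexive x+d≡t)) π
        piece seen (suc b) zero {x} s≤x x+d≡t _ π = stay (inj₂ x≡t) (≤-reflexive x≡t) π
          where x≡t = trans (sym (+-identityʳ x)) x+d≡t
        piece seen (suc b) (suc d) {x} {ps} {B} s≤x x+d≡t ps⊆B π = step (exit? s t x)
          where
          1+x+d≡t : suc x + d ≡ t
          1+x+d≡t = trans (sym (+-suc x d)) x+d≡t

          x<t : x < t
          x<t = m+n≤o⇒m≤o _ (≤-reflexive 1+x+d≡t)

          extendCover : ∀ {y B′} → (∀ {o} → Exit s t x o → block o ∈ B′) →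
                        (∀ {z o} → suc x ≤ z → z < y → Exit s t z o → block o ∈ B′) →
                        ∀ {z o} → x ≤ z → z < y → Exit s t z o → block o ∈ B′
          extendCover at-x rest x≤z z<y e with m≤n⇒m<n∨m≡n x≤z
          ... | inj₁ x<z  = rest x<z z<y e
          ... | inj₂ refl = at-x e

          unchanged : (∀ {o} → Exit s t x o → block o ∈ B) → Piece (suc b) x ps B
          unchanged at-x = record
            { advance = inj₁ P.x≤end ; x≤end = <⇒≤ P.x≤end ; end≤t = P.end≤t ; piles = P.piles
            ; grows = P.grows ; size = P.size ; covers = extendCover (P.grows ∘ at-x) P.covers
            ; progress = P.progress }
            where module P = Piece (piece seen (suc b) d (m≤n⇒m≤1+n s≤x) 1+x+d≡t ps⊆B (weakenPiles π))

          step : Dec (∃[ o ] Exit s t x o) → Piece (suc b) x ps B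
          step (no none) = unchanged (λ e → contradiction (_ , e) none)
          step (yes (o , e@(_ , link , _)))
            with insert s≤x x<t e (seen s≤x x<t e) emptyChain π
          ... | inj₁ β∈ps = unchanged (λ { (_ , link′ , _) → subst (λ o → block o ∈ B) (link-unique link link′) (ps⊆B β∈ps) })
          ... | inj₂ (ps₁ , π₁ , Φ< , ps₁⊆) = record
            { advance = inj₁ P.x≤end ; x≤end = <⇒≤ P.x≤end ; end≤t = P.end≤t ; piles = P.piles
            ; grows = P.grows ∘ there ; size = subst (length P.B′ ≤_) (sym (+-suc (length B) b)) P.size
            ; covers = extendCover
                (λ { (_ , link′ , _) → subst (λ o → block o ∈ P.B′) (link-unique link link′) (P.grows (here refl)) })
                P.covers
            ; progress = Sum.map₂ (λ Φ₁≤ → subst (_≤ Φ P.ps′) (sym (+-suc (Φ ps) b))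
                (≤-trans (+-monoˡ-≤ b Φ<) Φ₁≤)) P.progress }
            where
            module P = Piece (piece seen b d {B = block o ∷ B} (m≤n⇒m≤1+n s≤x) 1+x+d≡t
              (∷⁺ʳ _ ps⊆B ∘ ps₁⊆) π₁)

        -- A binary tree of pillars of depth at most `h`; the blocks listed at a leaf are those of
        -- `𝓑`, before any of these pillars is placed.
        data Split : ℕ → ℕ → ℕ → Set where
          leaf : ∀ {h x y B} → length B ≤ 3 * ω →
                 (∀ {z o} → x ≤ z → z < y → Exit s t z o → block o ∈ B) → Split h x y
          node : ∀ {h x y} q → x < q → q < y → Split h x q → Split h q y → Split (suc h) x y

        module _ (seen : Seen 𝓑 A) (|A|≤ : length A ≤ 5 * ω) where

          -- If a tree of depth `h` does not reach `t`, all its `2 ^ h` stretches have used up their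
          -- changes, each raising the potential by `2 * ω`.
          scan : ∀ h {x ps} → s ≤ x → x < t → Piles A x 0 ps →
                 Split h x t ⊎ (∃[ q ] ∃[ ps′ ] x < q × q < t × Split h x q × Piles A q 0 ps′ ×
                                Φ ps + 2 ^ h * (2 * ω) ≤ Φ ps′)
          scan zero {x} {ps} s≤x x<t π = finish P.progress P.advance
            where
            module P = Piece (piece seen (2 * ω) (t ∸ x) {B = ps} s≤x (m+[n∸m]≡n (<⇒≤ x<t)) id π)

            small : Split 0 x P.end
            -- At most `ω` piles at the start and `2 * ω` changes.
            small = leaf (≤-trans P.size (+-monoˡ-≤ (2 * ω) (piles≤ω (emptyChain {p = 0}) π))) P.covers

            finish : P.end ≡ t ⊎ Φ ps + 2 * ω ≤ Φ P.ps′ → x < P.end ⊎ 2 * ω ≡ 0 ⊎ x ≡ t → _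
            finish (inj₁ end≡t) _ = inj₁ (subst (Split 0 x) end≡t small)
            finish (inj₂ Φ≤) (inj₂ (inj₂ x≡t)) = contradiction x≡t (<⇒≢ x<t)
            finish (inj₂ Φ≤) (inj₂ (inj₁ 2ω≡0)) = contradiction (≤-trans ω≥1 (m≤m+n ω _)) (<⇒≱ (s≤s (≤-reflexive 2ω≡0)))
            finish (inj₂ Φ≤) (inj₁ x<end) with m≤n⇒m<n∨m≡n P.end≤t
            ... | inj₂ end≡t = inj₁ (subst (Split 0 x) end≡t small)
            ... | inj₁ end<t = inj₂ (P.end , P.ps′ , x<end , end<t , small , P.piles
                                    , subst (λ m → Φ ps + m ≤ Φ P.ps′) (sym (*-identityˡ (2 * ω))) Φ≤)
          scan (suc h) {x} {ps} s≤x x<t π with scan h s≤x x<t π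
          ... | inj₁ (leaf small cov) = inj₁ (leaf small cov)
          ... | inj₁ (node q x<q q<t a b) = inj₁ (node q x<q q<t (lift a) (lift b))
            where
            lift : ∀ {h x y} → Split h x y → Split (suc h) x y
            lift (leaf small cov) = leaf small cov
            lift (node q x<q q<y a b) = node q x<q q<y (lift a) (lift b)
          ... | inj₂ (q , ps₁ , x<q , q<t , a , π₁ , Φ₁) with scan h (≤-trans s≤x (<⇒≤ x<q)) q<t π₁
          ...   | inj₁ b = inj₁ (node q x<q q<t a b)
          ...   | inj₂ (q′ , ps₂ , q<q′ , q′<t , b , π₂ , Φ₂) = inj₂
            (q′ , ps₂ , <-trans x<q q<q′ , q′<t , node q x<q q<q′ a b , π₂ , bound)
            where
            open ≤-Reasoning
            double : ∀ m u v → m + (u + (u + 0)) * v ≡ m + u * v + u * v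
            double = solve-∀

            bound : Φ ps + 2 ^ suc h * (2 * ω) ≤ Φ ps₂
            bound = begin
              Φ ps + 2 ^ suc h * (2 * ω)                ≡⟨ double (Φ ps) (2 ^ h) (2 * ω) ⟩
              Φ ps + 2 ^ h * (2 * ω) + 2 ^ h * (2 * ω)  ≤⟨ +-monoˡ-≤ _ Φ₁ ⟩
              Φ ps₁ + 2 ^ h * (2 * ω)                   ≤⟨ Φ₂ ⟩
              Φ ps₂                                     ∎

          -- Starting without piles, a failed scan would lift the potential beyond its maximum, by
          -- `budget`.
          split : s < t → Split (2 * ω) s t
          split s<t with scan (2 * ω) {s} {[]} ≤-refl s<t []
          ... | inj₁ a = a
          ... | inj₂ (q , ps′ , _ , _ , _ , π , Φ≥) = contradiction Φ≥ (<⇒≱ (≤-<-trans Φ≤5ω² (budget ω≥1)))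
            where
            Φ≤5ω² : Φ ps′ ≤ ω * (5 * ω)
            Φ≤5ω² = ≤-trans (Φ≤ ps′) (*-mono-≤ (piles≤ω (emptyChain {p = 0}) π) |A|≤)

    -- Recursive placement of the pillars

    Colour : Set
    Colour = Fin (7 * ω)

    module _ {x y : ℕ} (𝓑 : Blocks Colour x y) where
      open Blocks 𝓑

      -- The new pillar takes a colour missing on the blocks seen. Since `χ` is constant on blocks,
      -- it then avoids every exit, as `join` demands.
      step : ∀ {A q} → Seen 𝓑 A → length A < 7 * ω → (x<q : x < q) (q<y : q < y) →
             (∀ κ → Solution x q (Blocks.χ (leftBlocks 𝓑 q κ q<y))) →
             (∀ κ → Solution q y (Blocks.χ (rightBlocks 𝓑 q κ x<q))) → Solution x y χ
      step {A} {q} seen |A|< x<q q<y solveˡ solveʳ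
        with fresh (map χ A) (subst (_< 7 * ω) (sym (length-map χ A)) |A|<)
      ... | κ , κ∉ = join q κ x<q (<⇒≤ q<y) bounded
        (λ { x≤z z<y e@(_ , _ , y≤o , o<) refl →
             κ∉ (subst (_∈ map χ A) (uniform y≤o o<) (∈-map⁺ χ (seen x≤z z<y e))) })
        (solveˡ κ) (solveʳ κ)

    aColour : Colour
    aColour = proj₁ (fresh [] (≤-trans ω≥1 (m≤m+n ω _)))

    module Tree {s t : ℕ} (𝓑₀ : Blocks Colour s t) {A : List ℕ} (seen₀ : Seen 𝓑₀ A)
      (|A|≤ : length A ≤ 5 * ω) (f : ℕ)
      (solve : ∀ {x y} (𝓑 : Blocks Colour x y) {B} → Seen 𝓑 B → length B ≤ 5 * ω →
               y ≤ x + f → Solution x y (Blocks.χ 𝓑)) where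
      open Sorting 𝓑₀

      -- Keeps the blocks of the root segment apart from those made by pillars higher up in the
      -- tree.
      Old : List ℕ → ℕ → ℕ → ℕ → Set
      Old New z o p = (Exit s t z o × p ≡ Blocks.block 𝓑₀ o) ⊎ p ∈ New

      -- `New` gains one block per level, so a leaf sees at most `3 * ω + 2 * ω` blocks and the
      -- bound for `solve` is restored. `status` says that the segment is already shorter than the
      -- root or is still the root.
      solveTree : ∀ {h x y New} (𝓑 : Blocks Colour x y) → s ≤ x → y ≤ t → OnExits 𝓑 (Old New) →
                  length New + h ≤ 2 * ω →
                  y ≤ x + f ⊎ (New ≡ [] × suc x < y × y ≤ x + suc f) →
                  Split A h x y → Solution x y (Blocks.χ 𝓑)
      solveTree {h} {x} {y} {New} 𝓑 s≤x y≤t old |New|≤ status (leaf {B = B} |B|≤ covers) = go status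
        where
        seen : Seen 𝓑 (B ++ New)
        seen x≤z z<y e with old x≤z z<y e
        ... | inj₁ (e₀ , eq) = ∈-++⁺ˡ (subst (_∈ B) (sym eq) (covers x≤z z<y e₀))
        ... | inj₂ p∈New     = ∈-++⁺ʳ B p∈New

        |B++New|≤ : length (B ++ New) ≤ 5 * ω
        |B++New|≤ = subst₂ _≤_ (sym (length-++ B)) (sym (*-distribʳ-+ ω 3 2))
          (+-mono-≤ |B|≤ (m+n≤o⇒m≤o _ |New|≤))

        seenRoot : New ≡ [] → Seen 𝓑 B
        seenRoot refl x≤z z<y e with old x≤z z<y e
        ... | inj₁ (e₀ , eq) = subst (_∈ B) (sym eq) (covers x≤z z<y e₀)

        1+|B|≤ : suc (length B) ≤ 5 * ω
        1+|B|≤ = ≤-trans (+-mono-≤ ω≥1 |B|≤) (+-monoʳ-≤ ω (*-monoˡ-≤ ω {3} {4} (n≤1+n 3)))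

        go : _ → Solution x y (Blocks.χ 𝓑)
        go (inj₁ short) = solve 𝓑 seen |B++New|≤ short
        -- The root itself is a leaf: an extra pillar after its first position makes both halves
        -- shorter, each seeing one more block than `B`.
        go (inj₂ (New≡[] , 1+x<y , y≤)) = step 𝓑 root
          (≤-trans 1+|B|≤ (*-monoˡ-≤ ω {5} {7} (m≤m+n 5 2))) ≤-refl 1+x<y
          (λ κ → solve (leftBlocks 𝓑 (suc x) κ 1+x<y)
             (leftExits 𝓑 _ κ {λ _ _ p → p ∈ suc x ∷ B}
               (λ a b e → there (root a b e)) 1+x<y (here refl)) 1+|B|≤
             (s≤s⁻¹ (≤-trans 1+x<y y≤1+x+f)))
          (λ κ → solve (rightBlocks 𝓑 (suc x) κ ≤-refl)
             (rightExits 𝓑 _ κ {λ _ _ p → p ∈ x + N ∷ B}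
               (λ a b e → there (root a b e)) ≤-refl (here refl)) 1+|B|≤ y≤1+x+f)
          where
          root = seenRoot New≡[]

          y≤1+x+f : y ≤ suc x + f
          y≤1+x+f = subst (y ≤_) (+-suc x f) y≤
      solveTree {suc h} {x} {y} {New} 𝓑 s≤x y≤t old |New|≤ status (node q x<q q<y a b) =
        step 𝓑 seen |A++New|< x<q q<y
          (λ κ → solveTree (leftBlocks 𝓑 q κ q<y) s≤x (≤-trans (<⇒≤ q<y) y≤t)
             (leftExits 𝓑 q κ {Old (q ∷ New)} (grow old) q<y (inj₂ (here refl))) 1+|New|≤
             (inj₁ (s≤s⁻¹ (≤-trans q<y y≤1+x+f))) a)
          (λ κ → solveTree (rightBlocks 𝓑 q κ x<q) (≤-trans s≤x (<⇒≤ x<q)) y≤t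
             (rightExits 𝓑 q κ {Old (x + N ∷ New)} (grow old) x<q (inj₂ (here refl))) 1+|New|≤
             (inj₁ (≤-trans y≤1+x+f (+-monoˡ-≤ f x<q))) b)
        where
        y≤1+x+f : y ≤ suc x + f
        y≤1+x+f = Sum.[ m≤n⇒m≤1+n , (λ (_ , _ , y≤) → subst (y ≤_) (+-suc x f) y≤) ] status

        1+|New|≤ : suc (length New) + h ≤ 2 * ω
        1+|New|≤ = subst (_≤ 2 * ω) (+-suc (length New) h) |New|≤

        grow : ∀ {p} → OnExits 𝓑 (Old New) → OnExits 𝓑 (Old (p ∷ New))
        grow old x≤z z<y e = Sum.map₂ there (old x≤z z<y e)

        seen : Seen 𝓑 (A ++ New)
        seen x≤z z<y e with old x≤z z<y e
        ... | inj₁ (e₀ , eq) = ∈-++⁺ˡ (subst (_∈ A) (sym eq) (seen₀ (≤-trans s≤x x≤z) (<-≤-trans z<y y≤t) e₀))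
        ... | inj₂ p∈New     = ∈-++⁺ʳ A p∈New

        -- Strict because the node itself takes up one of the `2 * ω` levels.
        |A++New|< : length (A ++ New) < 7 * ω
        |A++New|< = subst₂ _<_ (sym (length-++ A)) (sym (*-distribʳ-+ ω 5 2))
          (+-mono-≤-< |A|≤ (m+n≤o⇒m≤o _ 1+|New|≤))

    -- Induction on the bound `f` for the length of the segment, keeping at most `5 * ω` blocks in
    -- sight.
    solve : ∀ f {s t} (𝓑 : Blocks Colour s t) {A} → Seen 𝓑 A → length A ≤ 5 * ω →
            t ≤ s + f → Solution s t (Blocks.χ 𝓑)
    solve zero {s} _ _ _ t≤s =
      trivial-solution (m≤n⇒m≤1+n (≤-trans t≤s (≤-reflexive (+-identityʳ s)))) aColour
    solve (suc f) {s} {t} 𝓑 {A} seen |A|≤ t≤ with t ≤? suc s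
    ... | yes t≤1+s = trivial-solution t≤1+s aColour
    ... | no t≰1+s  = solveTree 𝓑 ≤-refl ≤-refl (λ _ _ e → inj₁ (e , refl)) ≤-refl
      (inj₂ (refl , ≰⇒> t≰1+s , t≤)) (split A seen |A|≤ (<-trans (n<1+n s) (≰⇒> t≰1+s)))
      where
      open Tree 𝓑 seen |A|≤ f (solve f)
      open Sorting 𝓑

    pillarColouring : PillarColouring l r Colour
    pillarColouring = record
      { pillar   = pillar
      ; colour   = colour
      ; pierces  = λ i → pierces i z≤n (r<N i)
      ; separate = λ { eq (inj₁ x) → ordered eq x ; eq (inj₂ x) → sym (ordered (sym eq) x) }
      }
      where
      -- The outside of [0 , N) is empty, so its blocks and colours are arbitrary.
      whole : Blocks Colour 0 N
      whole = record
        { block = id ; χ = const aColour ; bounded = ≤-refl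
        ; mono = λ _ o≤o′ _ → o≤o′ ; lower = λ N≤o _ → N≤o
        ; upper = λ _ _ → ≤-refl ; uniform = λ _ _ → refl }

      open Solution (solve N whole {[]} (λ _ _ (_ , _ , N≤o , o<N) → contradiction o<N (≤⇒≯ N≤o)) z≤n ≤-refl)

      ordered : ∀ {i j} → colour i ≡ colour j → Cross i j → pillar i ≡ pillar j
      ordered {i} {j} eq x = separate i j z≤n (r<N i) z≤n (r<N j) x eq

lookup-pairs : ∀ {A : Set} {R : A → A → Set} → (∀ {x y} → R x y → R y x) →
               ∀ {xs} → AllPairs R xs → ∀ {i j} → i ≢ j → R (lookup xs i) (lookup xs j)
lookup-pairs sym (Rx ∷ Rxs) {zero}  {zero}  i≢j = contradiction refl i≢j
lookup-pairs sym (Rx ∷ Rxs) {zero}  {suc j} i≢j = All.lookup Rx (∈-lookup j)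
lookup-pairs sym (Rx ∷ Rxs) {suc i} {zero}  i≢j = sym (All.lookup Rx (∈-lookup i))
lookup-pairs sym (Rx ∷ Rxs) {suc i} {suc j} i≢j = lookup-pairs sym Rxs (i≢j ∘ cong suc)

-- The order of the reals

open ℝ
open Interval
open IntervalSystem

lower-downward : ∀ x {p q} → p ℚ.≤ q → lower x q → lower x p
lower-downward x {p} {q} p≤q q∈ with ℚ.<-cmp p q
... | tri< p<q _ _  = Equivalence.from (lower-rounded x p) (q , p<q , q∈)
... | tri≈ _ refl _ = q∈
... | tri> _ _ q<p  = contradiction (ℚ.<-≤-trans q<p p≤q) (ℚ.<-irrefl refl)

<ℝ-trans : ∀ {x y z} → x <ℝ y → y <ℝ z → x <ℝ z
<ℝ-trans {x} {y} {z} (q , x<q , q<y) (r , y<r , r<z) with ℚ.≤-total r q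
... | inj₁ r≤q = contradiction (lower-downward y r≤q q<y , y<r) (disjoint y r)
... | inj₂ q≤r = q , x<q , lower-downward z q≤r r<z

<ℝ-irrefl : ∀ {x} → ¬ x <ℝ x
<ℝ-irrefl {x} (q , x<q , q<x) = disjoint x q (q<x , x<q)

<ℝ-asym : ∀ {x y} → x <ℝ y → ¬ y <ℝ x
<ℝ-asym {x} {y} x<y y<x = <ℝ-irrefl {x} (<ℝ-trans {x} {y} {x} x<y y<x)

-- Roundedness gives rationals on both sides of the separating `q`, so `q` itself lies strictly
-- between.
<ℝ-dense : ∀ {x y} → x <ℝ y → ∃[ z ] x <ℝ z × z <ℝ y
<ℝ-dense {x} {y} (q , x<q , q<y) =
  let p , p<q , x<p = Equivalence.to (upper-rounded x q) x<q
      r , q<r , r<y = Equivalence.to (lower-rounded y q) q<y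
  in fromℚ q , (p , x<p , p<q) , (r , q<r , r<y)

Crossℝ : Interval → Interval → Set
Crossℝ I J = left I <ℝ left J × left J <ℝ right I × right I <ℝ right J

crossℝ⇒overlap : ∀ {I J} → Crossℝ I J → Overlap I J
crossℝ⇒overlap {I} {J} (lI<lJ , lJ<rI , rI<rJ) = meet (<ℝ-dense {left J} {right I} lJ<rI) , I⊈J , J⊈I
  where
  meet : _ → ∃[ z ] ⟦ I ⟧ z × ⟦ J ⟧ z
  meet (z , lJ<z , z<rI) = z , (<ℝ-trans {left I} {left J} {z} lI<lJ lJ<z , z<rI)
                             , (lJ<z , <ℝ-trans {z} {right I} {right J} z<rI rI<rJ)

  I⊈J : ¬ (∀ {z} → ⟦ I ⟧ z → ⟦ J ⟧ z)
  I⊈J I⊆J with <ℝ-dense {left I} {left J} lI<lJ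
  ... | z , lI<z , z<lJ = <ℝ-asym {z} {left J} z<lJ
    (proj₁ (I⊆J {z} (lI<z , <ℝ-trans {z} {left J} {right I} z<lJ lJ<rI)))

  J⊈I : ¬ (∀ {z} → ⟦ J ⟧ z → ⟦ I ⟧ z)
  J⊈I J⊆I with <ℝ-dense {right I} {right J} rI<rJ
  ... | z , rI<z , z<rJ = <ℝ-asym {right I} {z} rI<z
    (proj₂ (J⊆I {z} (<ℝ-trans {left J} {right I} {z} lJ<rI rI<z , z<rJ)))

overlap-sym : ∀ {I J} → Overlap I J → Overlap J I
overlap-sym ((z , z∈I , z∈J) , I⊈J , J⊈I) = (z , z∈J , z∈I) , J⊈I , I⊈J

-- Ends in opposite orders would nest the intervals; otherwise the common point gives the middle
-- inequality.
overlap⇒crossℝ : ∀ {I J} → left I #ℝ left J → right I #ℝ right J → Overlap I J → Crossℝ I J ⊎ Crossℝ J I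
overlap⇒crossℝ {I} {J} l#l r#r ov@((x , (lI<x , x<rI) , (lJ<x , x<rJ)) , I⊈J , J⊈I) = go l#l r#r
  where
  go : left I #ℝ left J → right I #ℝ right J → Crossℝ I J ⊎ Crossℝ J I
  go (inj₁ lI<lJ) (inj₁ rI<rJ) = inj₁ (lI<lJ , <ℝ-trans {left J} {x} {right I} lJ<x x<rI , rI<rJ)
  go (inj₁ lI<lJ) (inj₂ rJ<rI) = contradiction
    (λ {z} (lJ<z , z<rJ) → <ℝ-trans {left I} {left J} {z} lI<lJ lJ<z , <ℝ-trans {z} {right J} {right I} z<rJ rJ<rI) J⊈I
  go (inj₂ lJ<lI) (inj₁ rI<rJ) = contradiction
    (λ {z} (lI<z , z<rI) → <ℝ-trans {left J} {left I} {z} lJ<lI lI<z , <ℝ-trans {z} {right I} {right J} z<rI rI<rJ) I⊈J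
  go (inj₂ lJ<lI) (inj₂ rJ<rI) = inj₂ (lJ<lI , <ℝ-trans {left I} {x} {right J} lI<x x<rJ , rJ<rI)

-- Ends of an interval system as integer positions

End : ℕ → Set
End n = Fin n ⊎ Fin n

module _ {n : ℕ} (S : IntervalSystem n) where

  endpoint : End n → ℝ
  endpoint (inj₁ i) = left (intervals S i)
  endpoint (inj₂ i) = right (intervals S i)

  endpoints-apart : ∀ a b → a ≢ b → endpoint a #ℝ endpoint b
  endpoints-apart (inj₁ i) (inj₁ j) a≢b = proj₁ (proj₁ (disjointEnds S (a≢b ∘ cong inj₁)))
  endpoints-apart (inj₂ i) (inj₂ j) a≢b = proj₂ (proj₂ (disjointEnds S (a≢b ∘ cong inj₂)))
  endpoints-apart (inj₁ i) (inj₂ j) a≢b with i Fin.≟ j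
  ... | yes refl = inj₁ (left<right (intervals S i))
  ... | no i≢j   = proj₂ (proj₁ (disjointEnds S i≢j))
  endpoints-apart (inj₂ i) (inj₁ j) a≢b with i Fin.≟ j
  ... | yes refl = inj₂ (left<right (intervals S i))
  ... | no i≢j   = proj₁ (proj₂ (disjointEnds S i≢j))

  OrderEmbedding : (End n → ℕ) → Set
  OrderEmbedding pos = ∀ a b → endpoint a <ℝ endpoint b ⇔ pos a < pos b

  module _ {pos : End n → ℕ} (embeds : OrderEmbedding pos) where
    open Crossings (pos ∘ inj₁) (pos ∘ inj₂)

    overlap⇔crossing : ∀ i j → Overlap (intervals S i) (intervals S j) ⇔ Crossing i j
    overlap⇔crossing i j = mk⇔ to from
      where
      I = intervals S

      up : ∀ a b → endpoint a <ℝ endpoint b → pos a < pos b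
      up a b = Equivalence.to (embeds a b)

      down : ∀ a b → pos a < pos b → endpoint a <ℝ endpoint b
      down a b = Equivalence.from (embeds a b)

      cross⁺ : ∀ i j → Crossℝ (I i) (I j) → Cross i j
      cross⁺ i j (p , q , r) = up (inj₁ i) (inj₁ j) p , up (inj₁ j) (inj₂ i) q , up (inj₂ i) (inj₂ j) r

      cross⁻ : ∀ i j → Cross i j → Crossℝ (I i) (I j)
      cross⁻ i j (p , q , r) = down (inj₁ i) (inj₁ j) p , down (inj₁ j) (inj₂ i) q , down (inj₂ i) (inj₂ j) r

      to : Overlap (I i) (I j) → Crossing i j
      to ov with i Fin.≟ j
      ... | yes refl = ⊥-elim (proj₁ (proj₂ ov) id)
      ... | no i≢j   = Sum.map (cross⁺ i j) (cross⁺ j i) (overlap⇒crossℝ {I i} {I j}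
        (endpoints-apart (inj₁ i) (inj₁ j) (i≢j ∘ inj₁-injective))
        (endpoints-apart (inj₂ i) (inj₂ j) (i≢j ∘ inj₂-injective)) ov)

      from : Crossing i j → Overlap (I i) (I j)
      from (inj₁ x) = crossℝ⇒overlap {I i} {I j} (cross⁻ i j x)
      from (inj₂ x) = overlap-sym {I j} {I i} (crossℝ⇒overlap {I j} {I i} (cross⁻ j i x))

  _≟End_ : (a b : End n) → Dec (a ≡ b)
  _≟End_ = Sum.≡-dec Fin._≟_ Fin._≟_

  -- Decidable for ends, though not for arbitrary reals, because distinct ends are apart.
  endpoint-<? : ∀ a b → Dec (endpoint a <ℝ endpoint b)
  endpoint-<? a b with a ≟End b
  ... | yes refl = no (<ℝ-irrefl {endpoint a})
  ... | no a≢b with endpoints-apart a b a≢b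
  ...   | inj₁ a<b = yes a<b
  ...   | inj₂ b<a = no (<ℝ-asym {endpoint b} {endpoint a} b<a)

  ends : List (End n)
  ends = map inj₁ (allFin n) ++ map inj₂ (allFin n)

  ∈-ends : ∀ a → a ∈ ends
  ∈-ends (inj₁ i) = ∈-++⁺ˡ (∈-map⁺ inj₁ (∈-allFin i))
  ∈-ends (inj₂ i) = ∈-++⁺ʳ (map inj₁ (allFin n)) (∈-map⁺ inj₂ (∈-allFin i))

  abstract

    rank : End n → ℕ
    rank a = length (filter (λ b → endpoint-<? b a) ends)

    rankBound : ℕ
    rankBound = suc (length ends)

    rank-bounded : ∀ a → rank a < rankBound
    rank-bounded a = s≤s (length-filter (λ b → endpoint-<? b a) ends)

    rank-mono : ∀ a b → endpoint a <ℝ endpoint b → rank a < rank b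
    rank-mono a b a<b = filter-length-< (λ c → endpoint-<? c a) (λ c → endpoint-<? c b)
      (λ c c<a → <ℝ-trans {endpoint c} {endpoint a} {endpoint b} c<a a<b)
      (∈-ends a) a<b (<ℝ-irrefl {endpoint a})

  rank-injective : ∀ a b → rank a ≡ rank b → a ≡ b
  rank-injective a b eq with a ≟End b
  ... | yes a≡b = a≡b
  ... | no a≢b  = contradiction eq
    (Sum.[ <⇒≢ ∘ rank-mono a b , >⇒≢ ∘ rank-mono b a ]′ (endpoints-apart a b a≢b))

  rank-embeds : OrderEmbedding rank
  rank-embeds a b = mk⇔ (rank-mono a b) from
    where
    from : rank a < rank b → endpoint a <ℝ endpoint b
    from a<b with endpoints-apart a b (λ { refl → <-irrefl refl a<b })
    ... | inj₁ p = p
    ... | inj₂ p = contradiction (rank-mono b a p) (<⇒≯ a<b)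

-- Realising a permutation diagram

fromℚᵘ-mono-< : ∀ {p q} → p ℚᵘ.< q → ℚ.fromℚᵘ p ℚ.< ℚ.fromℚᵘ q
fromℚᵘ-mono-< {p} {q} p<q = ℚ.toℚᵘ-cancel-<
  (ℚᵘ.<-respˡ-≃ (ℚᵘ.≃-sym (ℚ.toℚᵘ-fromℚᵘ p)) (ℚᵘ.<-respʳ-≃ (ℚᵘ.≃-sym (ℚ.toℚᵘ-fromℚᵘ q)) p<q))

fromℚ-mono : ∀ {p q} → p ℚ.< q → fromℚ p <ℝ fromℚ q
fromℚ-mono p<q = let r , p<r , r<q = ℚ.<-dense p<q in r , p<r , r<q

-- This is (k+1)/(k+2), as `mkℚᵘ` takes the denominator minus one: an increasing sequence inside
-- (0,1).
fraction : ℕ → ℚᵘ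
fraction k = mkℚᵘ (ℤ.+ suc k) (suc k)

abstract

  point : ℕ → ℝ
  point k = fromℚ (ℚ.fromℚᵘ (fraction k))

  0<point : ∀ k → 0ℝ <ℝ point k
  0<point k = fromℚ-mono (fromℚᵘ-mono-< {mkℚᵘ (ℤ.+ 0) 0} {fraction k} (ℚᵘ.*<* (ℤ.+<+ z<s)))

  point<1 : ∀ k → point k <ℝ 1ℝ
  point<1 k = fromℚ-mono (fromℚᵘ-mono-< {fraction k} {mkℚᵘ (ℤ.+ 1) 0} (ℚᵘ.*<* (ℤ.+<+ below)))
    where
    below : suc k * 1 < 1 * suc (suc k)
    below = subst₂ _<_ (sym (*-identityʳ (suc k))) (sym (*-identityˡ (suc (suc k)))) (n<1+n (suc k))

  point-mono : ∀ {j k} → j < k → point j <ℝ point k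
  point-mono {j} {k} j<k = fromℚ-mono (fromℚᵘ-mono-< {fraction j} {fraction k} (ℚᵘ.*<* (ℤ.+<+ cross)))
    where
    open ≤-Reasoning

    expand : ∀ j k → suc j * suc (suc k) ≡ j * k + j + k + 2 + j
    expand = solve-∀

    swapped : ∀ j k → j * k + j + k + 2 + k ≡ suc k * suc (suc j)
    swapped = solve-∀

    cross : suc j * suc (suc k) < suc k * suc (suc j)
    cross = begin-strict
      suc j * suc (suc k)        ≡⟨ expand j k ⟩
      j * k + j + k + 2 + j      <⟨ +-monoʳ-< (j * k + j + k + 2) j<k ⟩
      j * k + j + k + 2 + k      ≡⟨ swapped j k ⟩
      suc k * suc (suc j)        ∎

point-cancel : ∀ {j k} → point j <ℝ point k → j < k
point-cancel {j} {k} p<p with <-cmp j k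
... | tri< j<k _ _  = j<k
... | tri≈ _ refl _ = contradiction p<p (<ℝ-irrefl {point j})
... | tri> _ _ k<j  = contradiction p<p (<ℝ-asym {point k} {point j} (point-mono k<j))

point-apart : ∀ {j k} → j ≢ k → point j #ℝ point k
point-apart {j} {k} j≢k with <-cmp j k
... | tri< j<k _ _ = inj₁ (point-mono j<k)
... | tri≈ _ j≡k _ = contradiction j≡k j≢k
... | tri> _ _ k<j = inj₂ (point-mono k<j)

module PillarDiagram {m : ℕ} (l r : Fin m → ℕ) (b : ℕ)
  (l<b : ∀ i → l i < b) (b<r : ∀ i → b < r i)
  (l-injective : ∀ {i j} → l i ≡ l j → i ≡ j)
  (r-injective : ∀ {i j} → r i ≡ r j → i ≡ j) where

  system : IntervalSystem m
  system = record
    { intervals    = λ i → interval (point (l i)) (point (r i)) (point-mono (<-trans (l<b i) (b<r i)))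
    ; contained    = λ i {x} (l<x , x<r) → <ℝ-trans {0ℝ} {point (l i)} {x} (0<point (l i)) l<x
                                         , <ℝ-trans {x} {point (r i)} {1ℝ} x<r (point<1 (r i))
    ; disjointEnds = λ {i} {j} i≢j →
        ( point-apart (i≢j ∘ l-injective) , inj₁ (point-mono (<-trans (l<b i) (b<r j))))
        , (inj₂ (point-mono (<-trans (l<b j) (b<r i))) , point-apart (i≢j ∘ r-injective))
    ; 0-notEnd     = λ i → inj₁ (0<point (l i)) , inj₁ (0<point (r i))
    ; 1-notEnd     = λ i → inj₂ (point<1 (l i)) , inj₂ (point<1 (r i))
    }

  position : End m → ℕ
  position = Sum.[ l , r ]′

  position-embeds : OrderEmbedding system position
  position-embeds (inj₁ i) (inj₁ j) = mk⇔ point-cancel point-mono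
  position-embeds (inj₁ i) (inj₂ j) = mk⇔ point-cancel point-mono
  position-embeds (inj₂ i) (inj₁ j) = mk⇔ point-cancel point-mono
  position-embeds (inj₂ i) (inj₂ j) = mk⇔ point-cancel point-mono

  pillar : ∃[ x ] IsPillar system x × (∀ i → ⟦ intervals system i ⟧ x)
  pillar = point b
    , ((0<point b , point<1 b) , λ i → inj₂ (point-mono (l<b i)) , inj₁ (point-mono (b<r i)))
    , λ i → point-mono (l<b i) , point-mono (b<r i)

-- Chords with different pillars are moved into nested groups, keeping the
-- order of the ends of chords with the same pillar.

module Nesting {n : ℕ} (N : ℕ) (l r p : Fin n → ℕ)
  (l<N : ∀ i → l i < N) (r<N : ∀ i → r i < N) (p≤N : ∀ i → p i ≤ N)
  (l<p : ∀ i → l i < p i) (p≤r : ∀ i → p i ≤ r i)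
  (l-injective : ∀ {i j} → l i ≡ l j → i ≡ j)
  (r-injective : ∀ {i j} → r i ≡ r j → i ≡ j) where

  middle : ℕ
  middle = N * N + N

  -- Lexicographic codes, first by pillar and then by position. The order of pillars is reversed on
  -- the right, so a chord with a smaller pillar encloses one with a larger.
  l⁺ r⁺ : Fin n → ℕ
  l⁺ i = p i * N + l i
  r⁺ i = suc middle + ((N ∸ p i) * N + r i)

  lex : ∀ {a a′ b b′} → a < a′ → b < N → a * N + b < a′ * N + b′
  lex {a} {a′} {b} {b′} a<a′ b<N = begin-strict
    a * N + b     <⟨ +-monoʳ-< (a * N) b<N ⟩
    a * N + N     ≡⟨ +-comm (a * N) N ⟩
    suc a * N     ≤⟨ *-monoˡ-≤ N a<a′ ⟩
    a′ * N        ≤⟨ m≤m+n (a′ * N) b′ ⟩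
    a′ * N + b′   ∎
    where open ≤-Reasoning

  l⁺<middle : ∀ i → l⁺ i < middle
  l⁺<middle i = +-mono-≤-< (*-monoˡ-≤ N (p≤N i)) (l<N i)

  middle<r⁺ : ∀ i → middle < r⁺ i
  middle<r⁺ i = s≤s (m≤m+n middle _)

  l⁺-outer : ∀ {i j} → p i < p j → l⁺ i < l⁺ j
  l⁺-outer {i} p<p = lex p<p (l<N i)

  r⁺-outer : ∀ {i j} → p i < p j → r⁺ j < r⁺ i
  r⁺-outer {i} {j} p<p = +-monoʳ-< (suc middle) (lex (∸-monoʳ-< p<p (p≤N j)) (r<N j))

  l⁺-injective : ∀ {i j} → l⁺ i ≡ l⁺ j → i ≡ j
  l⁺-injective {i} {j} eq with <-cmp (p i) (p j)
  ... | tri< p<p _ _ = contradiction eq (<⇒≢ (l⁺-outer p<p))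
  ... | tri> _ _ p<p = contradiction eq (>⇒≢ (l⁺-outer p<p))
  ... | tri≈ _ p≡p _ rewrite p≡p = l-injective (+-cancelˡ-≡ (p j * N) _ _ eq)

  r⁺-injective : ∀ {i j} → r⁺ i ≡ r⁺ j → i ≡ j
  r⁺-injective {i} {j} eq with <-cmp (p i) (p j)
  ... | tri< p<p _ _ = contradiction eq (>⇒≢ (r⁺-outer p<p))
  ... | tri> _ _ p<p = contradiction eq (<⇒≢ (r⁺-outer p<p))
  ... | tri≈ _ p≡p _ rewrite p≡p =
    r-injective (+-cancelˡ-≡ ((N ∸ p j) * N) _ _ (+-cancelˡ-≡ (suc middle) _ _ eq))

  module Old = Crossings l r
  module New = Crossings l⁺ r⁺

  cross⁺ : ∀ {i j} → p i ≡ p j → Old.Cross i j → New.Cross i j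
  cross⁺ {i} {j} p≡p (l<l , _ , r<r) =
      subst (λ q → p i * N + l i < q * N + l j) p≡p (+-monoʳ-< (p i * N) l<l)
    , <-trans (l⁺<middle j) (middle<r⁺ i)
    , +-monoʳ-< (suc middle) (subst (λ q → (N ∸ p i) * N + r i < (N ∸ q) * N + r j) p≡p
        (+-monoʳ-< ((N ∸ p i) * N) r<r))

  cross⁻ : ∀ {i j} → New.Cross i j → Old.Cross i j
  cross⁻ {i} {j} (l<l , _ , r<r) with <-cmp (p i) (p j)
  ... | tri< p<p _ _ = contradiction r<r (<⇒≯ (r⁺-outer p<p))
  ... | tri> _ _ p<p = contradiction l<l (<⇒≯ (l⁺-outer p<p))
  ... | tri≈ _ p≡p _ =
      +-cancelˡ-< (p j * N) _ _ (subst (λ q → q * N + l i < p j * N + l j) p≡p l<l)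
    -- In the new diagram this inequality always holds; in the old one it comes from the common
    -- pillar.
    , <-≤-trans (l<p j) (subst (_≤ r i) p≡p (p≤r i))
    , +-cancelˡ-< ((N ∸ p j) * N) _ _
        (subst (λ q → (N ∸ q) * N + r i < (N ∸ p j) * N + r j) p≡p (+-cancelˡ-< (suc middle) _ _ r<r))

  crossing⇔ : ∀ {i j} → (Old.Crossing i j → p i ≡ p j) → Old.Crossing i j ⇔ New.Crossing i j
  crossing⇔ same = mk⇔
    (λ x → Sum.map (cross⁺ (same x)) (cross⁺ (sym (same x))) x)
    (Sum.map cross⁻ cross⁻)

-- The partition of a circle graph

module Partition {v e} (G : Graph v e) (ω : ℕ) (ω≥1 : 1 ≤ ω) {n : ℕ} (S : IntervalSystem n) (G≅S : G ≅ overlapGraph S)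
  (maximal : ∀ k → HasClique G k → k ≤ ω) where
  open _≅_ G≅S
  open Inverse bijection using (to; from; strictlyInverseˡ; strictlyInverseʳ)

  N : ℕ
  N = rankBound S

  l r : Fin n → ℕ
  l = rank S ∘ inj₁
  r = rank S ∘ inj₂

  open Crossings l r

  l<r : ∀ i → l i < r i
  l<r i = rank-mono S (inj₁ i) (inj₂ i) (left<right (intervals S i))

  l-injective : ∀ {i j} → l i ≡ l j → i ≡ j
  l-injective eq = inj₁-injective (rank-injective S _ _ eq)

  r-injective : ∀ {i j} → r i ≡ r j → i ≡ j
  r-injective eq = inj₂-injective (rank-injective S _ _ eq)

  l≢r : ∀ {i j} → l i ≢ r j
  l≢r {i} {j} eq with () ← rank-injective S (inj₁ i) (inj₂ j) eq

  adjacent⇔crossing : ∀ {x y} → Graph.Adj G x y ⇔ Crossing (to x) (to y)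
  adjacent⇔crossing = overlap⇔crossing S (rank-embeds S) _ _ ⇔-∘ adjacency

  clique≤ : ∀ is → AllPairs Crossing is → length is ≤ ω
  clique≤ is pairwise = maximal (length is) (mk↣ {to = f} f-injective , f-adjacent)
    where
    f : Fin (length is) → Graph.Vertex G
    f = from ∘ lookup is

    f-adjacent : ∀ {i j} → i ≢ j → Graph.Adj G (f i) (f j)
    f-adjacent i≢j = Equivalence.from adjacent⇔crossing
      (subst₂ Crossing (sym (strictlyInverseˡ _)) (sym (strictlyInverseˡ _))
        (lookup-pairs Sum.swap pairwise i≢j))

    f-injective : ∀ {i j} → f i ≡ f j → i ≡ j
    f-injective {i} {j} eq = decidable-stable (i Fin.≟ j)
      (λ i≢j → Graph.irrefl G eq (f-adjacent i≢j))

  open PillarColouring (ChordDiagram.pillarColouring N l r l<r (rank-bounded S ∘ inj₂)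
    l-injective r-injective l≢r ω ω≥1 clique≤)

  part : Graph.Vertex G → Fin (7 * ω)
  part x = colour (to x)

  open Nesting N l r pillar (rank-bounded S ∘ inj₁) (rank-bounded S ∘ inj₂)
    (λ i → <⇒≤ (≤-<-trans (proj₂ (pierces i)) (rank-bounded S (inj₂ i))))
    (proj₁ ∘ pierces) (proj₂ ∘ pierces) l-injective r-injective

  module _ (k : Fin (7 * ω)) where

    has-k? : ∀ i → Dec (colour i ≡ k)
    has-k? i = colour i Fin.≟ k

    members : List (Fin n)
    members = filter has-k? (allFin n)

    member : Fin (length members) → Fin n
    member = lookup members

    member-colour : ∀ a → colour (member a) ≡ k
    member-colour a = proj₂ (∈-filter⁻ has-k? {xs = allFin n} (∈-lookup a))

    member-injective : ∀ {a b} → member a ≡ member b → a ≡ b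
    member-injective {a} {b} eq = decidable-stable (a Fin.≟ b)
      (λ a≢b → lookup-pairs (_∘ sym) (filter⁺ has-k? (allFin⁺ n)) a≢b eq)

    K : Graph v e
    K = induced G (λ x → part x ≡ k)

    -- The proof carried by a vertex is irrelevant; decidable equality of colours recovers a usable
    -- one.
    membership : (x : Graph.Vertex K) → to (value x) ∈ members
    membership (x , [ px ]) = ∈-filter⁺ has-k? (∈-allFin (to x)) (recompute (part x Fin.≟ k) px)

    index : Graph.Vertex K → Fin (length members)
    index x = Any.index (membership x)

    member-index : ∀ x → member (index x) ≡ to (value x)
    member-index x = sym (lookup-index (membership x))

    vertex : Fin (length members) → Graph.Vertex K
    vertex a = from (member a) , [ trans (cong colour (strictlyInverseˡ (member a))) (member-colour a) ]

    open PillarDiagram (l⁺ ∘ member) (r⁺ ∘ member) middle (l⁺<middle ∘ member) (middle<r⁺ ∘ member)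
      (member-injective ∘ l⁺-injective) (member-injective ∘ r⁺-injective)
      renaming (pillar to commonPillar)

    adjacent⇔overlap : ∀ {x y} → Graph.Adj K x y ⇔
                       Overlap (intervals system (index x)) (intervals system (index y))
    adjacent⇔overlap {x} {y} =
      ⇔-sym (overlap⇔crossing system position-embeds (index x) (index y)) ⇔-∘
      (crossing⇔ (separate (trans (member-colour (index x)) (sym (member-colour (index y))))) ⇔-∘
      subst₂ (λ i j → Graph.Adj K x y ⇔ Crossing i j) (sym (member-index x)) (sym (member-index y))
        adjacent⇔crossing)

    isPermutationGraph : IsPermutationGraph K
    isPermutationGraph = length members , system , commonPillar , record
      { bijection = mk↔ₛ′ index vertex
          (λ a → member-injective (trans (member-index (vertex a)) (strictlyInverseˡ (member a))))
          (λ x → value-injective (trans (cong from (member-index x)) (strictlyInverseʳ (value x))))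
      ; adjacency = λ {x} {y} → adjacent⇔overlap {x} {y}
      }

theorem2 : ∀ {v e} (G : Graph v e) (ω : ℕ) →
    IsCircleGraph G → IsCliqueNumber G ω →
    Σ (Graph.Vertex G → Fin (7 * ω)) λ part →
    ∀ k → IsPermutationGraph (induced G (λ x → part x ≡ k))
-- A vertex would be a clique of size 1, so there are neither vertices nor parts.
theorem2 G zero _ (_ , maximal) = (λ x → contradiction (maximal 1 (single x)) λ ()) , λ ()
  where
  single : Graph.Vertex G → HasClique G 1
  single x = mk↣ {to = const x} (λ { {zero} {zero} _ → refl })
           , λ { {zero} {zero} i≢i → contradiction refl i≢i }
theorem2 G (suc w) (n , S , G≅S) (_ , maximal) = part , isPermutationGraph
  where open Partition G (suc w) (s≤s z≤n) S G≅S maximal
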